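{- Let $D$ be a digraph of order $n$ and $2\le k\le n$. Then: (i) $0\le \lambda_k(D)+\lambda_k(D^c)\le n-1$; both bounds are sharp, and the lower bound holds with equality if and only if $\lambda(D)=\lambda(D^c)=0$. (ii) $0\le \lambda_k(D)\lambda_k(D^c)\le \left(\frac{n-1}{2}\right)^2$; both bounds are sharp, and the lower bound holds with equality if and only if $\lambda(D)=0$ or $\lambda(D^c)=0$.
   Context: Digraphs are finite, without loops or parallel arcs. The complement $D^c$ of $D$ has vertex set $V(D)$, and $xy$ (for distinct $x,y$) is an arc of $D^c$ iff $xy$ is not an arc of $D$. $\lambda(D)$ is the arc-strong connectivity of $D$ (so $\lambda(D)=0$ iff $D$ is not strong). For $S\subseteq V(D)$, $\lambda_S(D)$ is the maximum number of pairwise arc-disjoint strong subgraphs of $D$ containing $S$, and $\lambda_k(D)=\min\{\lambda_S(D): S\subseteq V(D), |S|=k\}$. -}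

module Defs where

open import Data.Fin.Base using (Fin; zero; suc; combine; remQuot)
open import Data.Fin.Properties using (_≟_; all?; remQuot-combine; injective⇒≤)
open import Data.Fin.Subset using (Subset; inside; outside; _∈_; _∉_; _⊆_; _∩_; _∪_; _─_; ∁; ⊤; ∣_∣; Empty; Nonempty)
open import Data.Fin.Subset.Properties using (_∈?_; _⊆?_; ∈⊤; ∣p∣≤n; nonempty?; anySubset?; x∈p∩q⁺; x∈p∪q⁺; x∈p∪q⁻; x∈∁p⇒x∉p; x∉p⇒x∈∁p; p─q⊆p)
open import Data.List.Base using (List; []; _∷_; allFin)
open import Data.List.Membership.Propositional using () renaming (_∈_ to _∈ₗ_)
open import Data.List.Membership.Propositional.Properties using (∈-allFin)
open import Data.List.Relation.Unary.Any using (here; there)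
open import Data.Nat.Base using (ℕ; zero; suc; _*_; _≤_; _<_; z≤n; s≤s; s≤s⁻¹)
open import Data.Nat.Properties using (≤-trans; ≤-refl; ≤-antisym; _<?_; ≮⇒≥; ≤∧≢⇒<; m≤n⇒m<n∨m≡n) renaming (_≟_ to _≟ℕ_)
open import Data.Product using (∃; _×_; _,_; proj₁; proj₂; uncurry)
open import Data.Sum.Base using (_⊎_; inj₁; inj₂)
open import Data.Vec.Base using (Vec; []; _∷_; lookup; tabulate) renaming (here to hereᵥ; there to thereᵥ)
open import Data.Vec.Properties using (lookup∘tabulate; lookup⇒[]=; []=⇒lookup)
open import Function.Base using (_∘_; id)
open import Function.Bundles using (_⇔_; mk⇔)
open import Relation.Binary.Construct.Closure.ReflexiveTransitive using (Star; ε; _◅_; _◅◅_)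
open import Relation.Binary.PropositionalEquality using (_≡_; _≢_; refl; sym; trans; cong; subst; subst₂)
open import Relation.Nullary using (¬_; Dec; yes; no; does; contradiction)
open import Relation.Nullary.Decidable using (map′; _×-dec_; _⊎-dec_; _→-dec_; ¬?; decidable-stable; dec-true)
open import Relation.Unary using (Decidable)

private
  variable
    n m : ℕ

-- The arc xy is the element  combine x y  of  Fin (n * n) .
ArcSet : ℕ → Set
ArcSet n = Subset (n * n)

_⟶[_]_ : Fin n → ArcSet n → Fin n → Set
x ⟶[ A ] y = combine x y ∈ A

record Digraph (n : ℕ) : Set where
  field
    arcs     : ArcSet n
    loopless : (x : Fin n) → ¬ (x ⟶[ arcs ] x)

open Digraph public

-- Diagonal pairs; removed when complementing, so that D ᶜ has no loops.
loops : ∀ n → ArcSet n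
loops n = tabulate (λ a → does (uncurry _≟_ (remQuot {n} n a)))

loop-∈ : (x : Fin n) → x ⟶[ loops n ] x
loop-∈ {n} x = lookup⇒[]= (combine x x) (loops n)
  (trans (lookup∘tabulate _ (combine x x))
    (trans (cong (does ∘ uncurry _≟_) (remQuot-combine {n} x x)) (dec-true (x ≟ x) refl)))

∈-loops : (x y : Fin n) → x ⟶[ loops n ] y → x ≡ y
∈-loops {n} x y p with x ≟ y
                     | trans (cong (does ∘ uncurry _≟_) (sym (remQuot-combine {n} x y)))
                         (trans (sym (lookup∘tabulate _ (combine x y))) ([]=⇒lookup p))
... | yes x≡y | _ = x≡y

infix 8 _ᶜ

_ᶜ : Digraph n → Digraph n
_ᶜ {n} D = record
  { arcs     = ∁ (arcs D ∪ loops n)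
  ; loopless = λ x p → x∈∁p⇒x∉p p (x∈p∪q⁺ {p = arcs D} (inj₂ (loop-∈ x)))
  }

ᶜ-arcs : (D : Digraph n) (x y : Fin n) →
         (x ⟶[ arcs (D ᶜ) ] y) ⇔ (x ≢ y × ¬ (x ⟶[ arcs D ] y))
ᶜ-arcs {n} D x y = mk⇔
  (λ p → (λ { refl → loopless (D ᶜ) x p }) , (λ q → x∈∁p⇒x∉p p (x∈p∪q⁺ (inj₁ q))))
  (λ (x≢y , ¬q) → x∉p⇒x∈∁p (λ r → case₂ x≢y ¬q (x∈p∪q⁻ (arcs D) (loops n) r)))
  where
  case₂ : x ≢ y → ¬ (x ⟶[ arcs D ] y) → ¬ (x ⟶[ arcs D ] y ⊎ x ⟶[ loops n ] y)
  case₂ _   ¬q (inj₁ q) = ¬q q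
  case₂ x≢y _  (inj₂ l) = x≢y (∈-loops x y l)

infixl 5 _∖_

_∖_ : Digraph n → ArcSet n → Digraph n
D ∖ F = record
  { arcs     = arcs D ─ F
  ; loopless = λ x p → loopless D x (p─q⊆p (arcs D) F p)
  }

StrongOn : Subset n → ArcSet n → Set
StrongOn {n} U A = (x y : Fin n) → x ∈ U → y ∈ U → Star (_⟶[ A ]_) x y

Strong : Digraph n → Set
Strong {n} D = StrongOn {n} ⊤ (arcs D)

record Subgraph (D : Digraph n) : Set where
  field
    vertices  : Subset n
    subArcs   : ArcSet n
    subArcs⊆  : subArcs ⊆ arcs D
    endpoints : (x y : Fin n) → x ⟶[ subArcs ] y → x ∈ vertices × y ∈ vertices

open Subgraph public

StrongSubgraph : {D : Digraph n} → Subgraph D → Set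
StrongSubgraph H = StrongOn (vertices H) (subArcs H)

ArcDisjoint : {D : Digraph n} → Subgraph D → Subgraph D → Set
ArcDisjoint H K = Empty (subArcs H ∩ subArcs K)

record Packing (D : Digraph n) (S : Subset n) (m : ℕ) : Set where
  field
    member   : Fin m → Subgraph D
    strong   : ∀ i → StrongSubgraph (member i)
    contains : ∀ i → S ⊆ vertices (member i)
    disjoint : ∀ i j → i ≢ j → ArcDisjoint (member i) (member j)

IsMaximum : (ℕ → Set) → ℕ → Set
IsMaximum P m = P m × (∀ i → P i → i ≤ m)

IsMinimum : (ℕ → Set) → ℕ → Set
IsMinimum P m = P m × (∀ i → P i → m ≤ i)

ArcStrong : ℕ → Digraph n → Set
ArcStrong k D = ∀ F → F ⊆ arcs D → ∣ F ∣ < k → Strong (D ∖ F)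

-- λ(D): the largest k such that deleting fewer than k arcs never destroys
-- strongness.  For n ≤ 1 no maximum exists.
IsArcStrongConnectivity : Digraph n → ℕ → Set
IsArcStrongConnectivity D = IsMaximum (λ k → ArcStrong k D)

-- λ_S(D).  For ∣ S ∣ ≤ 1 no maximum exists: an arcless one-vertex subgraph
-- can be repeated arbitrarily often.
Isλ-S : Digraph n → Subset n → ℕ → Set
Isλ-S D S = IsMaximum (Packing D S)

-- λ_k(D)
Isλ-k : ℕ → Digraph n → ℕ → Set
Isλ-k k D = IsMinimum (λ m → ∃ λ S → ∣ S ∣ ≡ k × Isλ-S D S m)

max-unique : {P : ℕ → Set} {a b : ℕ} → IsMaximum P a → IsMaximum P b → a ≡ b
max-unique (pa , ua) (pb , ub) = ≤-antisym (ub _ pa) (ua _ pb)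

max-exists : {P : ℕ → Set} → Decidable P → P 0 → ∀ B → (∀ i → P i → i ≤ B) → ∃ (IsMaximum P)
max-exists P? p₀ zero    bd = 0 , p₀ , bd
max-exists {P} P? p₀ (suc B) bd with P? (suc B)
... | yes p = suc B , p , bd
... | no ¬p = max-exists P? p₀ B (λ i pᵢ → s≤s⁻¹ (≤∧≢⇒< (bd i pᵢ) (λ e → ¬p (subst P e pᵢ))))

min-exists : {P : ℕ → Set} → Decidable P → ∃ P → ∃ (IsMinimum P)
min-exists {P} P? (m , pₘ) with search (suc m)
  where
  search : ∀ b → ∃ (IsMinimum P) ⊎ (∀ i → i < b → ¬ P i)
  search zero = inj₂ (λ _ ())
  search (suc b) with search b
  ... | inj₁ r = inj₁ r
  ... | inj₂ none with P? b
  ...   | yes p = inj₁ (b , p , λ i pᵢ → ≮⇒≥ (λ i<b → none i i<b pᵢ))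
  ...   | no ¬p = inj₂ step
    where
    step : ∀ i → i < suc b → ¬ P i
    step i (s≤s i≤b) pᵢ with m≤n⇒m<n∨m≡n i≤b
    ... | inj₁ i<b  = none i i<b pᵢ
    ... | inj₂ refl = ¬p pᵢ
... | inj₁ r    = r
... | inj₂ none = contradiction pₘ (none m ≤-refl)

Searchable : Set → Set₁
Searchable X = {P : X → Set} → Decidable P → Dec (∃ P)

searchVec : {X : Set} → Searchable X → ∀ m → Searchable (Vec X m)
searchVec s zero    P? = map′ (λ p → [] , p) (λ { ([] , p) → p }) (P? [])
searchVec s (suc m) P? = map′
  (λ { (x , xs , p) → x ∷ xs , p })
  (λ { (x ∷ xs , p) → x , xs , p })
  (s (λ x → searchVec s m (λ xs → P? (x ∷ xs))))

searchPair : {X Y : Set} → Searchable X → Searchable Y → Searchable (X × Y)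
searchPair s t P? = map′
  (λ { (x , y , p) → (x , y) , p })
  (λ { ((x , y) , p) → x , y , p })
  (s (λ x → t (λ y → P? (x , y))))

-- Walks from x to y in A with interior in vs (Floyd–Warshall recursion).
Via : ArcSet n → List (Fin n) → Fin n → Fin n → Set
Via A []       x y = x ≡ y ⊎ x ⟶[ A ] y
Via A (v ∷ vs) x y = Via A vs x y ⊎ (Via A vs x v × Via A vs v y)

via? : (A : ArcSet n) (vs : List (Fin n)) (x y : Fin n) → Dec (Via A vs x y)
via? A []       x y = (x ≟ y) ⊎-dec (combine x y ∈? A)
via? A (v ∷ vs) x y = via? A vs x y ⊎-dec (via? A vs x v ×-dec via? A vs v y)

via⇒star : (A : ArcSet n) (vs : List (Fin n)) {x y : Fin n} → Via A vs x y → Star (_⟶[ A ]_) x y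
via⇒star A []       (inj₁ refl)    = ε
via⇒star A []       (inj₂ a)       = a ◅ ε
via⇒star A (v ∷ vs) (inj₁ p)       = via⇒star A vs p
via⇒star A (v ∷ vs) (inj₂ (p , q)) = via⇒star A vs p ◅◅ via⇒star A vs q

via-base : (A : ArcSet n) (vs : List (Fin n)) {x y : Fin n} → x ≡ y ⊎ x ⟶[ A ] y → Via A vs x y
via-base A []       p = p
via-base A (v ∷ vs) p = inj₁ (via-base A vs p)

via-trans : (A : ArcSet n) (vs : List (Fin n)) {x v y : Fin n} → v ∈ₗ vs →
            Via A vs x v → Via A vs v y → Via A vs x y
via-trans A (w ∷ ws) (here refl) p q = inj₂ (left p , right q)
  where
  left : ∀ {x} → Via A (w ∷ ws) x w → Via A ws x w
  left (inj₁ p)       = p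
  left (inj₂ (p , _)) = p
  right : ∀ {y} → Via A (w ∷ ws) w y → Via A ws w y
  right (inj₁ q)       = q
  right (inj₂ (_ , q)) = q
via-trans A (w ∷ ws) (there v∈) (inj₁ p)       (inj₁ q)       = inj₁ (via-trans A ws v∈ p q)
via-trans A (w ∷ ws) (there v∈) (inj₁ p)       (inj₂ (q , r)) = inj₂ (via-trans A ws v∈ p q , r)
via-trans A (w ∷ ws) (there v∈) (inj₂ (o , p)) (inj₁ q)       = inj₂ (o , via-trans A ws v∈ p q)
via-trans A (w ∷ ws) (there v∈) (inj₂ (o , _)) (inj₂ (_ , r)) = inj₂ (o , r)

star⇒via : (A : ArcSet n) {x y : Fin n} → Star (_⟶[ A ]_) x y → Via A (allFin n) x y
star⇒via {n} A ε              = via-base A (allFin n) (inj₁ refl)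
star⇒via {n} A (_◅_ {j = v} a p) =
  via-trans A (allFin n) (∈-allFin v) (via-base A (allFin n) (inj₂ a)) (star⇒via A p)

strongOn? : (U : Subset n) (A : ArcSet n) → Dec (StrongOn U A)
strongOn? {n} U A = all? λ x → all? λ y → (x ∈? U) →-dec ((y ∈? U) →-dec
  map′ (via⇒star A (allFin n)) (star⇒via A) (via? A (allFin n) x y))

arcStrong? : (D : Digraph n) → Decidable (λ k → ArcStrong k D)
arcStrong? {n} D k = map′ to from (¬? (anySubset? bad?))
  where
  Bad : ArcSet n → Set
  Bad F = F ⊆ arcs D × ∣ F ∣ < k × ¬ Strong (D ∖ F)
  strong? : ∀ F → Dec (Strong (D ∖ F))
  strong? F = strongOn? {n} ⊤ (arcs D ─ F)
  bad? : Decidable Bad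
  bad? F = (F ⊆? arcs D) ×-dec ((∣ F ∣ <? k) ×-dec ¬? (strong? F))
  to : ¬ ∃ Bad → ArcStrong k D
  to ¬b F F⊆ F< = decidable-stable (strong? F) (λ ¬s → ¬b (F , F⊆ , F< , ¬s))
  from : ArcStrong k D → ¬ ∃ Bad
  from s (F , F⊆ , F< , ¬s) = ¬s (s F F⊆ F<)

packing? : (D : Digraph n) (S : Subset n) → Decidable (Packing D S)
packing? {n} D S m = map′ to from (searchVec (searchPair anySubset? anySubset?) m good?)
  where
  Good₁ : Subset n × ArcSet n → Set
  Good₁ (U , A) = A ⊆ arcs D × ((x y : Fin n) → x ⟶[ A ] y → x ∈ U × y ∈ U) × StrongOn U A × S ⊆ U
  Good : Vec (Subset n × ArcSet n) m → Set
  Good v = (∀ i → Good₁ (lookup v i)) ×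
           (∀ i j → i ≢ j → Empty (proj₂ (lookup v i) ∩ proj₂ (lookup v j)))
  good₁? : Decidable Good₁
  good₁? (U , A) = (A ⊆? arcs D) ×-dec
    ((all? λ x → all? λ y → (combine x y ∈? A) →-dec ((x ∈? U) ×-dec (y ∈? U))) ×-dec
    (strongOn? U A ×-dec (S ⊆? U)))
  good? : Decidable Good
  good? v = (all? λ i → good₁? (lookup v i)) ×-dec
    (all? λ i → all? λ j → ¬? (i ≟ j) →-dec ¬? (nonempty? (proj₂ (lookup v i) ∩ proj₂ (lookup v j))))
  to : ∃ Good → Packing D S m
  to (v , g , d) = record
    { member   = λ i → record
        { vertices  = proj₁ (lookup v i)
        ; subArcs   = proj₂ (lookup v i)
        ; subArcs⊆  = proj₁ (g i)
        ; endpoints = proj₁ (proj₂ (g i)) }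
    ; strong   = λ i → proj₁ (proj₂ (proj₂ (g i)))
    ; contains = λ i → proj₂ (proj₂ (proj₂ (g i)))
    ; disjoint = d }
  from : Packing D S m → ∃ Good
  from P = tabulate raw , (λ i → subst Good₁ (sym (lookup∘tabulate raw i)) (g i)) ,
    (λ i j i≢j → subst₂ (λ a b → Empty (proj₂ a ∩ proj₂ b))
      (sym (lookup∘tabulate raw i)) (sym (lookup∘tabulate raw j)) (Packing.disjoint P i j i≢j))
    where
    raw : Fin m → Subset n × ArcSet n
    raw i = vertices (Packing.member P i) , subArcs (Packing.member P i)
    g : ∀ i → Good₁ (raw i)
    g i = subArcs⊆ (Packing.member P i) , endpoints (Packing.member P i) ,
          Packing.strong P i , Packing.contains P i

one-element : (S : Subset n) → 1 ≤ ∣ S ∣ → Nonempty S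
one-element (inside  ∷ S) _ = zero , hereᵥ
one-element (outside ∷ S) p with one-element S p
... | x , x∈S = suc x , thereᵥ x∈S

two-elements : (S : Subset n) → 2 ≤ ∣ S ∣ → ∃ λ x → ∃ λ y → x ≢ y × x ∈ S × y ∈ S
two-elements (inside ∷ S) (s≤s p) with one-element S p
... | y , y∈S = zero , suc y , (λ ()) , hereᵥ , thereᵥ y∈S
two-elements (outside ∷ S) p with two-elements S p
... | x , y , x≢y , x∈S , y∈S =
  suc x , suc y , (λ { refl → x≢y refl }) , thereᵥ x∈S , thereᵥ y∈S

first-arc : (A : ArcSet n) {x y : Fin n} → x ≢ y → Star (_⟶[ A ]_) x y → Nonempty A
first-arc A x≢y ε       = contradiction refl x≢y
first-arc A x≢y (a ◅ _) = _ , a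

packing-bound : (D : Digraph n) (S : Subset n) → 2 ≤ ∣ S ∣ → ∀ m → Packing D S m → m ≤ n * n
packing-bound {n} D S 2≤S m P with two-elements S 2≤S
... | x , y , x≢y , x∈S , y∈S = injective⇒≤ {f = f} inj
  where
  open Packing P
  arc : ∀ i → Nonempty (subArcs (member i))
  arc i = first-arc _ x≢y (strong i x y (contains i x∈S) (contains i y∈S))
  f : Fin m → Fin (n * n)
  f i = proj₁ (arc i)
  inj : ∀ {i j} → f i ≡ f j → i ≡ j
  inj {i} {j} e = decidable-stable (i ≟ j) λ i≢j → disjoint i j i≢j
    (f i , x∈p∩q⁺ (proj₂ (arc i) , subst (_∈ subArcs (member j)) (sym e) (proj₂ (arc j))))

emptyPacking : (D : Digraph n) (S : Subset n) → Packing D S 0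
emptyPacking D S = record { member = λ () ; strong = λ () ; contains = λ () ; disjoint = λ () }

arcStrong-bound : (D : Digraph n) → 2 ≤ n → ∀ k → ArcStrong k D → k ≤ n * n
arcStrong-bound {suc (suc _)} D (s≤s (s≤s _)) k s = ≮⇒≥ λ nn<k →
  absurd (first-arc _ (λ ()) (s (arcs D) id (≤-trans (s≤s (∣p∣≤n (arcs D))) nn<k) zero (suc zero) ∈⊤ ∈⊤))
  where
  ∉─ : ∀ {N} (A : Subset N) {z : Fin N} → z ∉ A ─ A
  ∉─ (inside  ∷ A) (thereᵥ p) = ∉─ A p
  ∉─ (outside ∷ A) (thereᵥ p) = ∉─ A p
  absurd : ¬ Nonempty (arcs D ─ arcs D)
  absurd (_ , p) = ∉─ (arcs D) p

k-subset : ∀ n k → k ≤ n → ∃ λ (S : Subset n) → ∣ S ∣ ≡ k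
k-subset zero    zero    _       = [] , refl
k-subset (suc n) zero    _ with k-subset n zero z≤n
... | S , e = outside ∷ S , e
k-subset (suc n) (suc k) (s≤s p) with k-subset n k p
... | S , e = inside ∷ S , cong suc e

arcStrongConnectivity-exists : (D : Digraph n) → 2 ≤ n → ∃ (IsArcStrongConnectivity D)
arcStrongConnectivity-exists {n} D 2≤n =
  max-exists (arcStrong? D) (λ _ _ ()) (n * n) (arcStrong-bound D 2≤n)

λ-S-exists : (D : Digraph n) (S : Subset n) → 2 ≤ ∣ S ∣ → ∃ (Isλ-S D S)
λ-S-exists {n} D S 2≤S =
  max-exists (packing? D S) (emptyPacking D S) (n * n) (packing-bound D S 2≤S)

λ-k-exists : (D : Digraph n) (k : ℕ) → 2 ≤ k → k ≤ n → ∃ (Isλ-k k D)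
λ-k-exists {n} D k 2≤k k≤n = min-exists (λ m → anySubset? (value? m)) nonempty
  where
  λS : (S : Subset n) → ∣ S ∣ ≡ k → ∃ (Isλ-S D S)
  λS S e = λ-S-exists D S (subst (2 ≤_) (sym e) 2≤k)
  value? : ∀ m → Decidable (λ S → ∣ S ∣ ≡ k × Isλ-S D S m)
  value? m S with ∣ S ∣ ≟ℕ k
  ... | no ≢k = no (≢k ∘ proj₁)
  ... | yes e with λS S e
  ...   | l , isl = map′ (λ { refl → e , isl }) (λ q → max-unique isl (proj₂ q)) (l ≟ℕ m)
  nonempty : ∃ λ m → ∃ λ S → ∣ S ∣ ≡ k × Isλ-S D S m
  nonempty with k-subset n k k≤n
  ... | S , e = proj₁ (λS S e) , S , e , proj₂ (λS S e)

arcStrongConnectivity : (D : Digraph n) → 2 ≤ n → ℕ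
arcStrongConnectivity D 2≤n = proj₁ (arcStrongConnectivity-exists D 2≤n)

arcStrongConnectivity-spec : (D : Digraph n) (2≤n : 2 ≤ n) →
  IsArcStrongConnectivity D (arcStrongConnectivity D 2≤n)
arcStrongConnectivity-spec D 2≤n = proj₂ (arcStrongConnectivity-exists D 2≤n)

-- The hypotheses 2 ≤ k and k ≤ n guarantee that the maxima λ_S(D) and the
-- minimum over S exist.
λₖ : (k : ℕ) (D : Digraph n) → 2 ≤ k → k ≤ n → ℕ
λₖ k D 2≤k k≤n = proj₁ (λ-k-exists D k 2≤k k≤n)

λₖ-spec : (k : ℕ) (D : Digraph n) (2≤k : 2 ≤ k) (k≤n : k ≤ n) → Isλ-k k D (λₖ k D 2≤k k≤n)
λₖ-spec k D 2≤k k≤n = proj₂ (λ-k-exists D k 2≤k k≤n)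

{-# OPTIONS --safe #-}

-- Upper bounds: if x ∈ S and ∣ S ∣ ≥ 2, every strong subgraph containing S
-- uses an arc leaving x, so λ_S(D) + λ_S(Dᶜ) is at most the sum n − 1 of the
-- out-degrees of x; the product bound is then AM-GM.  Equality in the lower
-- bounds: λ_k(D) and λ(D) are both positive exactly when D is strong, and a
-- transitive tournament and its complement are not strong.
--
-- Sharpness of the upper bounds, n = 2m + 1: take a vertex ∞ and the 2m
-- rotations of the zigzag 0, 1, −1, 2, −2, …, m of ℤ/2m, each closed to a
-- directed Hamiltonian cycle through ∞.  The consecutive differences
-- 1, −2, 3, −4, … of the zigzag are distinct modulo 2m, so these 2m = n − 1
-- cycles are arc-disjoint.  Half of them form D and the others lie in Dᶜ.
-- For n even and k < n, D is complete: S misses a vertex v, and the n − 2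
-- cycles on the remaining n − 1 vertices are joined by the star of all arcs
-- at v.

module Submission where

open import Defs
open import Data.Empty using (⊥)
open import Data.Fin.Base using (Fin; zero; suc; toℕ; fromℕ<; combine; remQuot; splitAt; _↑ˡ_; _↑ʳ_; punchIn)
open import Data.Fin.Properties using (_≟_; any?; remQuot-combine; combine-remQuot; injective⇒≤; toℕ-injective; toℕ<n; toℕ-fromℕ<; splitAt-↑ˡ; splitAt-↑ʳ; splitAt⁻¹-↑ˡ; splitAt⁻¹-↑ʳ; ↑ˡ-injective; ↑ʳ-injective; punchIn-injective; punchInᵢ≢i; punchIn-punchOut; ¬∀⟶∃¬)
open import Data.Fin.Subset using (Subset; inside; outside; _∈_; _∉_; _⊆_; _∩_; _∪_; ∁; ⊤; ∣_∣; ⁅_⁆; Empty) renaming (⊥ to ∅)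
open import Data.Fin.Subset.Properties using (_∈?_; ∈⊤; ∣⊤∣≡n; ∣⊥∣≡0; ∣⁅x⁆∣≡1; ∉⊥; x∈⁅x⁆; x≢y⇒x∉⁅y⁆; x∉⁅y⁆⇒x≢y; x∈∁p⇒x∉p; x∉p⇒x∈∁p; x∈p∪q⁺; x∈p∩q⁺; x∈p∩q⁻; p⊆q⇒∣p∣≤∣q∣; p─q⊆p; x∈p∧x∉q⇒x∈p─q; ∪-identityˡ)
open import Data.Integer.Base as ℤ using (+_; +≤+)
import Data.Integer.Properties as ℤ
open import Data.Nat.Base using (ℕ; zero; suc; _+_; _*_; _∸_; _≤_; _<_; z≤n; s≤s; s≤s⁻¹; ⌊_/2⌋)
open import Data.Nat.Divisibility using (_∣_; divides; ∣m+n∣m⇒∣n; ∣-trans; ∣1⇒≡1; m%n≡0⇒n∣m)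
open import Data.Nat.DivMod using (_%_; _mod_; %-distribˡ-+; [m+kn]%n≡m%n; m<n⇒m%n≡m; m%n<n; m%n%n≡m%n)
open import Data.Nat.Properties using (≤-trans; ≤-refl; ≤-reflexive; ≤-antisym; ≤-total; <-irrefl; <⇒≱; <⇒≤; ≰⇒>; ≮⇒≥; n≮0; n≢0⇒n>0; n<1⇒n≡0; 0≢1+n; suc-injective; _<?_; _≤?_; +-comm; +-suc; +-identityʳ; +-mono-≤; +-mono-<; +-monoˡ-≤; +-monoʳ-≤; +-cancelˡ-≤; +-cancelʳ-≤; *-mono-≤; m≤m+n; m≤n+m; m+n≡0⇒m≡0; m+n≡0⇒n≡0; m*n≡0⇒m≡0∨n≡0; *-zeroʳ; n≡⌊n+n/2⌋; m∸n+n≡m; ∸-monoˡ-≤) renaming (_≟_ to _≟ℕ_)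
open import Data.Nat.Tactic.RingSolver using (solve-∀)
open import Data.Product using (∃; _×_; _,_; proj₁; proj₂; uncurry)
open import Data.Rational.Base as ℚ using (ℚ; _/_; toℚᵘ)
open import Data.Rational.Properties using (toℚᵘ-homo-*; toℚᵘ-fromℚᵘ; toℚᵘ-injective; toℚᵘ-cancel-≤)
open import Data.Rational.Unnormalised.Base as ℚᵘ using (mkℚᵘ; *≡*; *≤*)
import Data.Rational.Unnormalised.Properties as ℚᵘ
open import Data.Sum.Base as Sum using (_⊎_; inj₁; inj₂; [_,_]′)
open import Data.Vec.Base using ([]; _∷_; lookup; tabulate; here; there)
open import Data.Vec.Properties using (lookup∘tabulate; lookup⇒[]=; []=⇒lookup)
open import Function.Base using (_∘_; id)
open import Function.Bundles using (_⇔_; mk⇔; module Equivalence)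
open import Relation.Binary.Construct.Closure.ReflexiveTransitive as Star using (Star; ε; _◅_; _◅◅_)
open import Relation.Binary.PropositionalEquality using (_≡_; _≢_; refl; sym; trans; cong; cong₂; subst; subst₂)
open import Relation.Nullary using (¬_; Dec; yes; no; does; contradiction)
open import Relation.Nullary.Decidable using (map′; _×-dec_; _⊎-dec_; ¬?; decidable-stable; dec-true)

private
  variable
    n l : ℕ

-- Parity, the AM-GM inequality and its rational form.

m+m-injective : ∀ {a b} → a + a ≡ b + b → a ≡ b
m+m-injective {a} {b} e = trans (n≡⌊n+n/2⌋ a) (trans (cong ⌊_/2⌋ e) (sym (n≡⌊n+n/2⌋ b)))

2∣m+m : ∀ m → 2 ∣ m + m
2∣m+m m = divides m (lemma m)
  where
  lemma : ∀ m → m + m ≡ m * 2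
  lemma = solve-∀

2∤1+m+m : ∀ m → ¬ (2 ∣ suc (m + m))
2∤1+m+m m 2∣ with () ← ∣1⇒≡1 (∣m+n∣m⇒∣n (subst (2 ∣_) (sym (+-comm (m + m) 1)) 2∣) (2∣m+m m))

even⊎odd : ∀ n → ∃ λ m → n ≡ m + m ⊎ n ≡ suc (m + m)
even⊎odd zero = 0 , inj₁ refl
even⊎odd (suc n) with even⊎odd n
... | m , inj₁ e = m , inj₂ (cong suc e)
... | m , inj₂ e = suc m , inj₁ (cong suc (trans e (sym (+-suc m m))))

-- The gap between the two sides is the square of the difference `d`; writing the larger number as
-- `d` plus the smaller turns this into an identity over ℕ.
4ab≤[a+b]² : ∀ a b → a * b * 4 ≤ (a + b) * (a + b)
4ab≤[a+b]² a b with ≤-total a b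
... | inj₁ a≤b = subst (λ b → a * b * 4 ≤ (a + b) * (a + b)) (m∸n+n≡m a≤b) (left a (b ∸ a))
  where
  eq : ∀ a d → (a + (d + a)) * (a + (d + a)) ≡ a * (d + a) * 4 + d * d
  eq = solve-∀
  left : ∀ a d → a * (d + a) * 4 ≤ (a + (d + a)) * (a + (d + a))
  left a d = subst (a * (d + a) * 4 ≤_) (sym (eq a d)) (m≤m+n _ (d * d))
... | inj₂ b≤a = subst (λ a → a * b * 4 ≤ (a + b) * (a + b)) (m∸n+n≡m b≤a) (right b (a ∸ b))
  where
  eq : ∀ b d → (d + b + b) * (d + b + b) ≡ (d + b) * b * 4 + d * d
  eq = solve-∀
  right : ∀ b d → (d + b) * b * 4 ≤ (d + b + b) * (d + b + b)
  right b d = subst ((d + b) * b * 4 ≤_) (sym (eq b d)) (m≤m+n _ (d * d))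

-- `_/_` cancels common factors, so the square is computed on unnormalised fractions. These store
-- the denominator minus one: `3` stands for 4 and `1` for 2.
[N/2]²-≃ : ∀ N → toℚᵘ (((+ N) / 2) ℚ.* ((+ N) / 2)) ℚᵘ.≃ mkℚᵘ (+ N ℤ.* + N) 3
[N/2]²-≃ N = ℚᵘ.≃-trans (toℚᵘ-homo-* ((+ N) / 2) ((+ N) / 2))
  (ℚᵘ.*-cong (toℚᵘ-fromℚᵘ (mkℚᵘ (+ N) 1)) (toℚᵘ-fromℚᵘ (mkℚᵘ (+ N) 1)))

≤[N/2]² : ∀ c N → c * 4 ≤ N * N → (+ c) / 1 ℚ.≤ ((+ N) / 2) ℚ.* ((+ N) / 2)
≤[N/2]² c N c≤ = toℚᵘ-cancel-≤ (ℚᵘ.≤-respʳ-≃ (ℚᵘ.≃-sym ([N/2]²-≃ N))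
  (ℚᵘ.≤-respˡ-≃ (ℚᵘ.≃-sym (toℚᵘ-fromℚᵘ (mkℚᵘ (+ c) 0)))
    (*≤* (subst₂ ℤ._≤_ (ℤ.pos-* c 4) (trans (ℤ.pos-* N N) (sym (ℤ.*-identityʳ _))) (+≤+ c≤)))))

≡[N/2]² : ∀ c N → c * 4 ≡ N * N → (+ c) / 1 ≡ ((+ N) / 2) ℚ.* ((+ N) / 2)
≡[N/2]² c N c≡ = toℚᵘ-injective (ℚᵘ.≃-trans (toℚᵘ-fromℚᵘ (mkℚᵘ (+ c) 0))
  (ℚᵘ.≃-trans
    (*≡* (trans (sym (ℤ.pos-* c 4)) (trans (cong +_ c≡) (trans (ℤ.pos-* N N) (sym (ℤ.*-identityʳ _))))))
    (ℚᵘ.≃-sym ([N/2]²-≃ N))))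

-- Subsets of prescribed size and counting.

superset-of-size : (T : Subset n) (k : ℕ) → ∣ T ∣ ≤ k → k ≤ n → ∃ λ S → ∣ S ∣ ≡ k × T ⊆ S
superset-of-size []            zero    _       _ = [] , refl , id
superset-of-size (inside ∷ T)  (suc k) (s≤s p) (s≤s q) with superset-of-size T k p q
... | S , e , T⊆S = inside ∷ S , cong suc e , λ { here → here ; (there x) → there (T⊆S x) }
superset-of-size {suc n} (outside ∷ T) k p q with k ≤? n
... | yes k≤n with superset-of-size T k p k≤n
...   | S , e , T⊆S = outside ∷ S , e , λ { (there x) → there (T⊆S x) }
-- Now `k` exceeds `n` and is at most `suc n`, so the whole set is the only choice.
superset-of-size {suc n} (outside ∷ T) k p q | no k≰n =
  ⊤ , trans (∣⊤∣≡n (suc n)) (≤-antisym (≰⇒> k≰n) q) , λ _ → ∈⊤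

∣⁅x⁆∪p∣≤1+∣p∣ : (x : Fin n) (p : Subset n) → ∣ ⁅ x ⁆ ∪ p ∣ ≤ suc ∣ p ∣
∣⁅x⁆∪p∣≤1+∣p∣ zero    (inside  ∷ p) rewrite ∪-identityˡ p = s≤s (<⇒≤ ≤-refl)
∣⁅x⁆∪p∣≤1+∣p∣ zero    (outside ∷ p) rewrite ∪-identityˡ p = ≤-refl
∣⁅x⁆∪p∣≤1+∣p∣ (suc x) (inside  ∷ p) = s≤s (∣⁅x⁆∪p∣≤1+∣p∣ x p)
∣⁅x⁆∪p∣≤1+∣p∣ (suc x) (outside ∷ p) = ∣⁅x⁆∪p∣≤1+∣p∣ x p

subset-through : (x y : Fin n) (k : ℕ) → 2 ≤ k → k ≤ n → ∃ λ S → ∣ S ∣ ≡ k × x ∈ S × y ∈ S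
subset-through x y k 2≤k k≤n with superset-of-size (⁅ x ⁆ ∪ ⁅ y ⁆) k ∣T∣≤k k≤n
  where
  ∣T∣≤k : ∣ ⁅ x ⁆ ∪ ⁅ y ⁆ ∣ ≤ k
  ∣T∣≤k = ≤-trans (∣⁅x⁆∪p∣≤1+∣p∣ x ⁅ y ⁆) (≤-trans (≤-reflexive (cong suc (∣⁅x⁆∣≡1 y))) 2≤k)
... | S , e , T⊆S = S , e , T⊆S (x∈p∪q⁺ (inj₁ (x∈⁅x⁆ x))) , T⊆S (x∈p∪q⁺ (inj₂ (x∈⁅x⁆ y)))

missed-vertex : (S : Subset n) → ∣ S ∣ < n → ∃ λ v → v ∉ S
missed-vertex {n} S ∣S∣<n = ¬∀⟶∃¬ n (_∈ S) (_∈? S) λ all →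
  <⇒≱ ∣S∣<n (subst (_≤ ∣ S ∣) (∣⊤∣≡n n) (p⊆q⇒∣p∣≤∣q∣ {p = ⊤} {q = S} (λ {x} _ → all x)))

-- Used with `x` a vertex and with `f`, `g` listing out-neighbours of `x` in a digraph and in its
-- complement; `suc` counts `x` itself, which yields n - 1 rather than n.
disjoint-injections : ∀ {a b} (x : Fin n) (f : Fin a → Fin n) (g : Fin b → Fin n) →
  (∀ {i j} → f i ≡ f j → i ≡ j) → (∀ {i j} → g i ≡ g j → i ≡ j) →
  (∀ i j → f i ≢ g j) → (∀ i → f i ≢ x) → (∀ j → g j ≢ x) → suc (a + b) ≤ n
disjoint-injections {n} {a} {b} x f g f-inj g-inj f≢g f≢x g≢x = injective⇒≤ {f = h} h-inj
  where
  h′ : Fin a ⊎ Fin b → Fin n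
  h′ = [ f , g ]′
  h′≢x : ∀ s → h′ s ≢ x
  h′≢x (inj₁ i) = f≢x i
  h′≢x (inj₂ j) = g≢x j
  h′-inj : ∀ s t → h′ s ≡ h′ t → s ≡ t
  h′-inj (inj₁ i) (inj₁ j) e = cong inj₁ (f-inj e)
  h′-inj (inj₁ i) (inj₂ j) e = contradiction e (f≢g i j)
  h′-inj (inj₂ i) (inj₁ j) e = contradiction (sym e) (f≢g j i)
  h′-inj (inj₂ i) (inj₂ j) e = cong inj₂ (g-inj e)
  splitAt-inj : ∀ i j → splitAt a {b} i ≡ splitAt a j → i ≡ j
  splitAt-inj i j e with splitAt a i in eᵢ
  ... | inj₁ _ = trans (sym (splitAt⁻¹-↑ˡ {i = i} eᵢ)) (splitAt⁻¹-↑ˡ {i = j} (sym e))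
  ... | inj₂ _ = trans (sym (splitAt⁻¹-↑ʳ {i = i} eᵢ)) (splitAt⁻¹-↑ʳ {i = j} (sym e))
  h : Fin (suc (a + b)) → Fin n
  h zero    = x
  h (suc i) = h′ (splitAt a i)
  h-inj : ∀ {i j} → h i ≡ h j → i ≡ j
  h-inj {zero}  {zero}  e = refl
  h-inj {zero}  {suc j} e = contradiction (sym e) (h′≢x (splitAt a j))
  h-inj {suc i} {zero}  e = contradiction e (h′≢x (splitAt a i))
  h-inj {suc i} {suc j} e = cong suc (splitAt-inj i j (h′-inj _ _ e))

-- Arc sets and packings given by decidable relations.

arcSet : {R : Fin n → Fin n → Set} → (∀ x y → Dec (R x y)) → ArcSet n
arcSet {n} R? = tabulate (does ∘ uncurry R? ∘ remQuot {n} n)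

lookup-arcSet : {R : Fin n → Fin n → Set} (R? : ∀ x y → Dec (R x y)) (x y : Fin n) →
                lookup (arcSet R?) (combine x y) ≡ does (R? x y)
lookup-arcSet {n} R? x y = trans (lookup∘tabulate _ (combine x y))
  (cong (does ∘ uncurry R?) (remQuot-combine {n} x y))

arcSet⁺ : {R : Fin n → Fin n → Set} (R? : ∀ x y → Dec (R x y)) {x y : Fin n} →
          R x y → x ⟶[ arcSet R? ] y
arcSet⁺ R? {x} {y} r = lookup⇒[]= (combine x y) (arcSet R?)
  (trans (lookup-arcSet R? x y) (dec-true (R? x y) r))

arcSet⁻ : {R : Fin n → Fin n → Set} (R? : ∀ x y → Dec (R x y)) {x y : Fin n} →
          x ⟶[ arcSet R? ] y → R x y
arcSet⁻ R? {x} {y} p with R? x y | trans (sym (lookup-arcSet R? x y)) ([]=⇒lookup p)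
... | yes r | _ = r

digraph : {R : Fin n → Fin n → Set} → (∀ x y → Dec (R x y)) → (∀ x → ¬ R x x) → Digraph n
digraph R? irr = record { arcs = arcSet R? ; loopless = λ x p → irr x (arcSet⁻ R? p) }

complete : ∀ n → Digraph n
complete n = digraph {n} (λ x y → ¬? (x ≟ y)) (λ x x≢x → x≢x refl)

complete⁺ : {x y : Fin n} → x ≢ y → x ⟶[ arcs (complete n) ] y
complete⁺ = arcSet⁺ (λ x y → ¬? (x ≟ y))

Empty-∩ : (A B : ArcSet n) → ((x y : Fin n) → x ⟶[ A ] y → x ⟶[ B ] y → ⊥) → Empty (A ∩ B)
Empty-∩ {n} A B disj (a , a∈) with x∈p∩q⁻ A B a∈
... | a∈A , a∈B = uncurry disj (remQuot {n} n a) (subst (_∈ A) (sym e) a∈A) (subst (_∈ B) (sym e) a∈B)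
  where
  e : uncurry combine (remQuot {n} n a) ≡ a
  e = combine-remQuot {n} n a

-- Members are described by relations on vertices and translated through the bijection between pairs
-- and arc codes. Disjointness takes the form in which it is proved later: an arc determines the
-- index of its member.
relationPacking : {D : Digraph n} {S : Subset n}
  (U : Fin l → Subset n) (R : Fin l → Fin n → Fin n → Set) → (∀ i x y → Dec (R i x y)) →
  (∀ i x y → R i x y → x ⟶[ arcs D ] y) →
  (∀ i x y → R i x y → x ∈ U i × y ∈ U i) →
  (∀ i x y → x ∈ U i → y ∈ U i → Star (R i) x y) →
  (∀ i → S ⊆ U i) →
  (∀ i j x y → R i x y → R j x y → i ≡ j) →
  Packing D S l
relationPacking {n} {l} {D} {S} U R R? R⊆D ends conn S⊆U disj = record
  { member   = λ i → record
      { vertices  = U i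
      ; subArcs   = arcSet (R? i)
      ; subArcs⊆  = λ {a} a∈ → subst (_∈ arcs D) (combine-remQuot {n} n a)
          (R⊆D i _ _ (arcSet⁻ (R? i) (subst (_∈ arcSet (R? i)) (sym (combine-remQuot {n} n a)) a∈)))
      ; endpoints = λ x y p → ends i x y (arcSet⁻ (R? i) p) }
  ; strong   = λ i x y x∈ y∈ → Star.map (arcSet⁺ (R? i)) (conn i x y x∈ y∈)
  ; contains = S⊆U
  ; disjoint = λ i j i≢j → Empty-∩ {n} (arcSet (R? i)) (arcSet (R? j)) λ x y p q →
      i≢j (disj i j x y (arcSet⁻ (R? i) {x} {y} p) (arcSet⁻ (R? j) {x} {y} q)) }

-- Out-neighbours and the upper bound on the sum.

out-arc : (A : ArcSet n) {x y : Fin n} → x ≢ y → Star (_⟶[ A ]_) x y → ∃ λ z → x ⟶[ A ] z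
out-arc A x≢y ε       = contradiction refl x≢y
out-arc A x≢y (a ◅ _) = _ , a

-- Each strong member contains `y` besides `x`, hence has an arc leaving `x`; equal heads would make
-- two members share that arc.
packing-out-neighbours : {D : Digraph n} {S : Subset n} {x y : Fin n} →
  x ≢ y → x ∈ S → y ∈ S → Packing D S l →
  ∃ λ (f : Fin l → Fin n) → (∀ {i j} → f i ≡ f j → i ≡ j) × (∀ i → x ⟶[ arcs D ] f i)
packing-out-neighbours {n} {l} {D} {x = x} {y} x≢y x∈S y∈S P =
  f , inj , λ i → subArcs⊆ (member i) (proj₂ (arc i))
  where
  open Packing P
  arc : ∀ i → ∃ λ z → x ⟶[ subArcs (member i) ] z
  arc i = out-arc _ x≢y (strong i x y (contains i x∈S) (contains i y∈S))
  f : Fin l → Fin n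
  f i = proj₁ (arc i)
  inj : ∀ {i j} → f i ≡ f j → i ≡ j
  inj {i} {j} e = decidable-stable (i ≟ j) λ i≢j → disjoint i j i≢j
    (combine x (f i) , x∈p∩q⁺
      (proj₂ (arc i) , subst (λ z → x ⟶[ subArcs (member j) ] z) (sym e) (proj₂ (arc j))))

packing-sum-bound : ∀ {a b} (D : Digraph n) (S : Subset n) → 2 ≤ ∣ S ∣ →
                    Packing D S a → Packing (D ᶜ) S b → a + b ≤ n ∸ 1
packing-sum-bound {n} D S 2≤S P Q with two-elements S 2≤S
... | x , y , x≢y , x∈S , y∈S
  with packing-out-neighbours x≢y x∈S y∈S P | packing-out-neighbours x≢y x∈S y∈S Q
... | f , f-inj , x→f | g , g-inj , x→g =
  ∸-monoˡ-≤ 1 (disjoint-injections x f g f-inj g-inj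
    (λ i j e → proj₂ (Equivalence.to (ᶜ-arcs D x (g j)) (x→g j)) (subst (x ⟶[ arcs D ]_) e (x→f i)))
    (λ i e → loopless D x (subst (x ⟶[ arcs D ]_) e (x→f i)))
    (λ j e → loopless (D ᶜ) x (subst (x ⟶[ arcs (D ᶜ) ]_) e (x→g j))))

-- λ_k, λ and strongness.

module _ {k : ℕ} (2≤k : 2 ≤ k) (k≤n : k ≤ n) where

  -- λ_S is one of the values whose minimum is λ_k, so a maximum packing for `S` has at least `a`
  -- members.
  λₖ-packing : ∀ {a} {D : Digraph n} → Isλ-k k D a → (S : Subset n) → ∣ S ∣ ≡ k →
               ∃ λ l → a ≤ l × Packing D S l
  λₖ-packing {D = D} (_ , min) S ∣S∣ with λ-S-exists D S (subst (2 ≤_) (sym ∣S∣) 2≤k)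
  ... | l , isλ = l , min l (S , ∣S∣ , isλ) , proj₁ isλ

  λₖ-sum-bound : ∀ {a b} {D : Digraph n} → Isλ-k k D a → Isλ-k k (D ᶜ) b → a + b ≤ n ∸ 1
  λₖ-sum-bound {D = D} isa isb with k-subset n k k≤n
  ... | S , ∣S∣ with λₖ-packing isa S ∣S∣ | λₖ-packing isb S ∣S∣
  ...   | _ , ≤a , P | _ , ≤b , Q =
    ≤-trans (+-mono-≤ ≤a ≤b) (packing-sum-bound D S (subst (2 ≤_) (sym ∣S∣) 2≤k) P Q)

  -- Since `k` is at least 2, some `S` of size `k` contains both given vertices, and any one member
  -- of its packing joins them.
  λₖ>0⇒strong : ∀ {a} {D : Digraph n} → Isλ-k k D a → 0 < a → Strong D
  λₖ>0⇒strong isa 0<a x y _ _ with subset-through x y k 2≤k k≤n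
  ... | S , ∣S∣ , x∈S , y∈S with λₖ-packing isa S ∣S∣
  ...   | l , a≤l , P = Star.map (subArcs⊆ (member i)) (strong i x y (contains i x∈S) (contains i y∈S))
    where
    open Packing P
    i : Fin l
    i = fromℕ< (≤-trans 0<a a≤l)

  ¬strong⇒λₖ≡0 : ∀ {a} {D : Digraph n} → Isλ-k k D a → ¬ Strong D → a ≡ 0
  ¬strong⇒λₖ≡0 {a} isa ¬s = decidable-stable (a ≟ℕ 0) λ ≢0 → ¬s (λₖ>0⇒strong isa (n≢0⇒n>0 ≢0))

-- The minimum is attained at some `S`, and there `a` bounds the size of every packing.
packings⇒≤λₖ : ∀ {k a} {D : Digraph n} → Isλ-k k D a → (∀ S → ∣ S ∣ ≡ k → Packing D S l) → l ≤ a
packings⇒≤λₖ ((S , ∣S∣ , _ , max) , _) P = max _ (P S ∣S∣)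

-- `D` itself is a one-member packing for every `S`.
strong⇒λₖ>0 : ∀ {k a} {D : Digraph n} → Isλ-k k D a → Strong D → 0 < a
strong⇒λₖ>0 {D = D} isa s = packings⇒≤λₖ isa λ S _ → record
  { member   = λ _ → record
      { vertices = ⊤ ; subArcs = arcs D ; subArcs⊆ = id ; endpoints = λ _ _ _ → ∈⊤ , ∈⊤ }
  ; strong   = λ _ → s
  ; contains = λ _ _ → ∈⊤
  ; disjoint = λ { zero zero 0≢0 → contradiction refl 0≢0 } }

∣p∣≡0⇒x∉p : ∀ {p : Subset n} {x} → ∣ p ∣ ≡ 0 → x ∉ p
∣p∣≡0⇒x∉p {p = inside  ∷ p} () here
∣p∣≡0⇒x∉p {p = outside ∷ p} e (there x∈p) = ∣p∣≡0⇒x∉p e x∈p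

-- Fewer than one arc means none, so `D ∖ F` keeps every arc of `D`.
strong⇒arcStrong-1 : (D : Digraph n) → Strong D → ArcStrong 1 D
strong⇒arcStrong-1 D s F _ ∣F∣<1 x y x∈ y∈ =
  Star.map (λ a → x∈p∧x∉q⇒x∈p─q a (∣p∣≡0⇒x∉p (n<1⇒n≡0 ∣F∣<1))) (s x y x∈ y∈)

arcStrong⇒strong : ∀ {k} (D : Digraph n) → 0 < k → ArcStrong k D → Strong D
arcStrong⇒strong {n} D 0<k s x y x∈ y∈ =
  Star.map (λ a → p─q⊆p (arcs D) ∅ a)
    (s ∅ (λ z∈ → contradiction z∈ ∉⊥) (subst (_< _) (sym (∣⊥∣≡0 (n * n))) 0<k) x y x∈ y∈)

¬strong⇒λ≡0 : ∀ {c} {D : Digraph n} → IsArcStrongConnectivity D c → ¬ Strong D → c ≡ 0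
¬strong⇒λ≡0 {c = c} {D} (s , _) ¬s =
  decidable-stable (c ≟ℕ 0) λ ≢0 → ¬s (arcStrong⇒strong D (n≢0⇒n>0 ≢0) s)

strong⇒λ>0 : ∀ {c} {D : Digraph n} → IsArcStrongConnectivity D c → Strong D → 0 < c
strong⇒λ>0 {D = D} (_ , max) s = max 1 (strong⇒arcStrong-1 D s)

λₖ≡0⇔λ≡0 : ∀ {k a c} {D : Digraph n} → 2 ≤ k → k ≤ n →
           Isλ-k k D a → IsArcStrongConnectivity D c → a ≡ 0 ⇔ c ≡ 0
λₖ≡0⇔λ≡0 {D = D} 2≤k k≤n isa isc = mk⇔
  (λ { refl → ¬strong⇒λ≡0 {D = D} isc (n≮0 ∘ strong⇒λₖ>0 isa) })
  (λ { refl → ¬strong⇒λₖ≡0 2≤k k≤n isa (n≮0 ∘ strong⇒λ>0 {D = D} isc) })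

-- Transitive tournaments.

transitiveTournament : ∀ n → Digraph n
transitiveTournament n = digraph {n} (λ x y → toℕ x <? toℕ y) (λ x → <-irrefl refl)

-- Along an arc the vertex number grows, so no walk leads from 1 to 0. Dually, arcs of the
-- complement never go up, so there no walk leads from 0 to 1.
transitiveTournament-¬strong : 2 ≤ n → ¬ Strong (transitiveTournament n)
transitiveTournament-¬strong {suc (suc n)} (s≤s (s≤s _)) s = n≮0 (increasing (s (suc zero) zero ∈⊤ ∈⊤))
  where
  increasing : ∀ {x y} → Star (_⟶[ arcs (transitiveTournament (suc (suc n))) ]_) x y → toℕ x ≤ toℕ y
  increasing ε       = ≤-refl
  increasing (a ◅ p) = ≤-trans (<⇒≤ (arcSet⁻ (λ x y → toℕ x <? toℕ y) a)) (increasing p)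

transitiveTournamentᶜ-¬strong : 2 ≤ n → ¬ Strong (transitiveTournament n ᶜ)
transitiveTournamentᶜ-¬strong {suc (suc n)} (s≤s (s≤s _)) s = n≮0 (decreasing (s zero (suc zero) ∈⊤ ∈⊤))
  where
  T : Digraph (suc (suc n))
  T = transitiveTournament _
  decreasing : ∀ {x y} → Star (_⟶[ arcs (T ᶜ) ]_) x y → toℕ y ≤ toℕ x
  decreasing ε = ≤-refl
  decreasing {x} (_◅_ {j = z} a p) = ≤-trans (decreasing p)
    (≮⇒≥ λ x<z →
      proj₂ (Equivalence.to (ᶜ-arcs T x z) a) (arcSet⁺ (λ x y → toℕ x <? toℕ y) x<z))

-- Adding a star to a packing of a smaller complete digraph.

-- The new member consists of all arcs into and out of `v`. The old ones are transported by
-- `punchIn v`, whose range misses `v`, so they share no arc with the star. The premise on `v` is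
-- indexed by `Fin l` and hence vacuous for the empty packing, from which the case n = 2 starts.
starPacking : ∀ {N} (v : Fin (suc N)) (S : Subset (suc N)) → (Fin l → v ∉ S) →
              Packing (complete N) ⊤ l → Packing (complete (suc N)) S (suc l)
starPacking {l} {N} v S v∉S P = relationPacking U R R? R⊆ ends conn S⊆U disj
  where
  open Packing P
  A : Fin l → ArcSet N
  A i = subArcs (member i)
  U : Fin (suc l) → Subset (suc N)
  U zero    = ⊤
  U (suc i) = ∁ ⁅ v ⁆
  R : Fin (suc l) → Fin (suc N) → Fin (suc N) → Set
  R zero    x y = (x ≡ v × y ≢ v) ⊎ (x ≢ v × y ≡ v)
  R (suc i) x y = ∃ λ a → ∃ λ b → punchIn v a ≡ x × punchIn v b ≡ y × a ⟶[ A i ] b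
  R? : ∀ i x y → Dec (R i x y)
  R? zero    x y = ((x ≟ v) ×-dec ¬? (y ≟ v)) ⊎-dec (¬? (x ≟ v) ×-dec (y ≟ v))
  R? (suc i) x y = any? λ a → any? λ b → (punchIn v a ≟ x) ×-dec ((punchIn v b ≟ y) ×-dec (combine a b ∈? A i))
  R⊆ : ∀ i x y → R i x y → x ⟶[ arcs (complete (suc N)) ] y
  R⊆ zero    x y (inj₁ (refl , y≢v)) = complete⁺ (y≢v ∘ sym)
  R⊆ zero    x y (inj₂ (x≢v , refl)) = complete⁺ x≢v
  R⊆ (suc i) x y (a , b , refl , refl , ab) = complete⁺ λ e →
    loopless (complete N) a (subArcs⊆ (member i)
      (subst (a ⟶[ A i ]_) (sym (punchIn-injective v a b e)) ab))
  ∈U : ∀ {x} → x ≢ v → x ∈ ∁ ⁅ v ⁆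
  ∈U x≢v = x∉p⇒x∈∁p (x≢y⇒x∉⁅y⁆ x≢v)
  ends : ∀ i x y → R i x y → x ∈ U i × y ∈ U i
  ends zero    x y _ = ∈⊤ , ∈⊤
  ends (suc i) x y (a , b , refl , refl , _) = ∈U (punchInᵢ≢i v a) , ∈U (punchInᵢ≢i v b)
  to-v : ∀ x → Star (R zero) x v
  to-v x with x ≟ v
  ... | yes refl = ε
  ... | no x≢v   = inj₂ (x≢v , refl) ◅ ε
  from-v : ∀ x → Star (R zero) v x
  from-v x with x ≟ v
  ... | yes refl = ε
  ... | no x≢v   = inj₁ (refl , x≢v) ◅ ε
  v≢ : ∀ {x} → x ∈ ∁ ⁅ v ⁆ → v ≢ x
  v≢ x∈ = x∉⁅y⁆⇒x≢y (x∈∁p⇒x∉p x∈) ∘ sym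
  conn : ∀ i x y → x ∈ U i → y ∈ U i → Star (R i) x y
  conn zero    x y _  _  = to-v x ◅◅ from-v y
  conn (suc i) x y x∈ y∈ = subst₂ (Star (R (suc i)))
    (punchIn-punchOut (v≢ x∈)) (punchIn-punchOut (v≢ y∈))
    (Star.gmap (punchIn v) (λ {a} {b} ab → a , b , refl , refl , ab)
      (strong i _ _ (contains i ∈⊤) (contains i ∈⊤)))
  S⊆U : ∀ i → S ⊆ U i
  S⊆U zero    _   = ∈⊤
  S⊆U (suc i) x∈S = ∈U λ { refl → v∉S i x∈S }
  disj : ∀ i j x y → R i x y → R j x y → i ≡ j
  disj zero    zero    x y _ _ = refl
  disj zero    (suc j) x y (inj₁ (e , _)) (a , b , refl , refl , _) = contradiction e (punchInᵢ≢i v a)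
  disj zero    (suc j) x y (inj₂ (_ , e)) (a , b , refl , refl , _) = contradiction e (punchInᵢ≢i v b)
  disj (suc i) zero    x y (a , b , refl , refl , _) (inj₁ (e , _)) = contradiction e (punchInᵢ≢i v a)
  disj (suc i) zero    x y (a , b , refl , refl , _) (inj₂ (_ , e)) = contradiction e (punchInᵢ≢i v b)
  disj (suc i) (suc j) x y (a , b , refl , refl , ab) (a′ , b′ , ea , eb , ab′) =
    cong suc (decidable-stable (i ≟ j) λ i≢j → disjoint i j i≢j
      (combine a b , x∈p∩q⁺ (ab ,
        subst₂ (λ a b → a ⟶[ A j ] b) (punchIn-injective v a′ a ea) (punchIn-injective v b′ b eb) ab′)))

-- Congruence modulo a positive number.

module Congruence (M-1 : ℕ) where

  M : ℕ
  M = suc M-1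

  infix 4 _≈_

  -- A record, because unification recovers `a` and `b` from it but not from an equation between
  -- remainders.
  record _≈_ (a b : ℕ) : Set where
    constructor mk≈
    field %-≡ : a % M ≡ b % M

  open _≈_ public

  _≈?_ : ∀ a b → Dec (a ≈ b)
  a ≈? b = map′ mk≈ %-≡ (a % M ≟ℕ b % M)

  ≈-reflexive : ∀ {a b} → a ≡ b → a ≈ b
  ≈-reflexive e = mk≈ (cong (_% M) e)

  ≈-refl : ∀ {a} → a ≈ a
  ≈-refl = mk≈ refl

  ≈-sym : ∀ {a b} → a ≈ b → b ≈ a
  ≈-sym (mk≈ e) = mk≈ (sym e)

  ≈-trans : ∀ {a b c} → a ≈ b → b ≈ c → a ≈ c
  ≈-trans (mk≈ e) (mk≈ f) = mk≈ (trans e f)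

  +-cong-≈ : ∀ {a b c d} → a ≈ b → c ≈ d → a + c ≈ b + d
  +-cong-≈ {a} {b} {c} {d} (mk≈ e) (mk≈ f) = mk≈
    (trans (%-distribˡ-+ a c M) (trans (cong₂ (λ u w → (u + w) % M) e f) (sym (%-distribˡ-+ b d M))))

  m+kM≈m : ∀ m k → m + k * M ≈ m
  m+kM≈m m k = mk≈ ([m+kn]%n≡m%n m k M)

  -- `k * M-1` plays the part of -k: together with `k` it makes a multiple of `M`. `difference`
  -- subtracts `b` in the same way.
  +-cancelˡ-≈ : ∀ k {a b} → k + a ≈ k + b → a ≈ b
  +-cancelˡ-≈ k {a} {b} e =
    ≈-trans (≈-sym (shift a)) (≈-trans (+-cong-≈ (≈-refl {k * M-1}) e) (shift b))
    where
    eq : ∀ k m c → k * m + (k + c) ≡ c + k * suc m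
    eq = solve-∀
    shift : ∀ c → k * M-1 + (k + c) ≈ c
    shift c = ≈-trans (≈-reflexive (eq k M-1 c)) (m+kM≈m c k)

  ≈⇒≡ : ∀ {a b} → a < M → b < M → a ≈ b → a ≡ b
  ≈⇒≡ a<M b<M (mk≈ e) = trans (sym (m<n⇒m%n≡m a<M)) (trans e (m<n⇒m%n≡m b<M))

  ≈⇒≡-Fin : ∀ {x y : Fin M} → toℕ x ≈ toℕ y → x ≡ y
  ≈⇒≡-Fin {x} {y} e = toℕ-injective (≈⇒≡ (toℕ<n x) (toℕ<n y) e)

  residue : ∀ a → ∃ λ (x : Fin M) → toℕ x ≈ a
  residue a = a mod M , mk≈ (trans (cong (_% M) (toℕ-fromℕ< (m%n<n a M))) (m%n%n≡m%n a M))

  difference : ∀ a b → ∃ λ (x : Fin M) → toℕ x + b ≈ a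
  difference a b with residue (a + b * M-1)
  ... | x , e = x , ≈-trans (+-cong-≈ e (≈-refl {b})) (≈-trans (≈-reflexive (eq a b M-1)) (m+kM≈m a b))
    where
    eq : ∀ a b m → a + b * m + b ≡ a + b * suc m
    eq = solve-∀

-- Arc-disjoint Hamiltonian cycles from the zigzag.

module Zigzag (p : ℕ) where

  m : ℕ
  m = suc p

  -- The argument is the modulus less one, so `M` unfolds to `m + m`.
  open Congruence (p + suc p)

  -- Vertex zero is ∞ and suc x is x ∈ ℤ/2m.  Cycle i is
  -- ∞, i, i + 1, i − 1, i + 2, …, i − p, i + m.
  Up Down : Fin M → Fin M → Fin M → Set
  Up   i x y = ∃ λ (a : Fin m) → toℕ x + toℕ a ≈ toℕ i × toℕ y ≈ toℕ i + suc (toℕ a)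
  Down i x y = ∃ λ (a : Fin p) → toℕ x ≈ toℕ i + suc (toℕ a) × toℕ y + suc (toℕ a) ≈ toℕ i

  Cycle : Fin M → Fin (suc M) → Fin (suc M) → Set
  Cycle i zero    zero    = ⊥
  Cycle i zero    (suc y) = y ≡ i
  Cycle i (suc x) zero    = toℕ x ≈ toℕ i + m
  Cycle i (suc x) (suc y) = Up i x y ⊎ Down i x y

  cycle? : ∀ i x y → Dec (Cycle i x y)
  cycle? i zero    zero    = no λ ()
  cycle? i zero    (suc y) = y ≟ i
  cycle? i (suc x) zero    = _ ≈? _
  cycle? i (suc x) (suc y) =
    (any? λ a → (_ ≈? _) ×-dec (_ ≈? _)) ⊎-dec (any? λ a → (_ ≈? _) ×-dec (_ ≈? _))

  -- An `Up` arc runs from i - a to i + a + 1, a `Down` arc from i + a + 1 to i - a - 1. The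
  -- differences 2a + 1 and -(2a + 2) do not involve `i`.
  up-difference : ∀ {i x y} ((a , _) : Up i x y) → toℕ y ≈ toℕ x + suc (toℕ a + toℕ a)
  up-difference {i} {x} {y} (a , x+a≈i , y≈) =
    ≈-trans y≈ (≈-trans (+-cong-≈ (≈-sym x+a≈i) (≈-refl {suc (toℕ a)})) (≈-reflexive (eq (toℕ x) (toℕ a))))
    where
    eq : ∀ x a → x + a + suc a ≡ x + suc (a + a)
    eq = solve-∀

  down-difference : ∀ {i x y} ((a , _) : Down i x y) → toℕ x ≈ toℕ y + (suc (toℕ a) + suc (toℕ a))
  down-difference {i} {x} {y} (a , x≈ , y+a≈i) =
    ≈-trans x≈ (≈-trans (+-cong-≈ (≈-sym y+a≈i) (≈-refl {suc (toℕ a)})) (≈-reflexive (eq (toℕ y) (suc (toℕ a)))))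
    where
    eq : ∀ x a → x + a + a ≡ x + (a + a)
    eq = solve-∀

  -- Staying below `M` lets congruent differences be compared as numbers, so that `a` can be read
  -- off.
  up-bound : (a : Fin m) → suc (toℕ a + toℕ a) < M
  up-bound a = subst (_≤ M) (cong suc (+-suc (toℕ a) (toℕ a))) (+-mono-≤ (toℕ<n a) (toℕ<n a))

  down-bound : (a : Fin p) → suc (toℕ a) + suc (toℕ a) < M
  down-bound a = +-mono-< (s≤s (toℕ<n a)) (s≤s (toℕ<n a))

  -- The modulus is even, so it has no odd multiple.
  odd≉0 : ∀ c → ¬ (suc (c + c) ≈ 0)
  odd≉0 c (mk≈ e) = 2∤1+m+m c (∣-trans (2∣m+m m) (m%n≡0⇒n∣m (suc (c + c)) M e))

  -- The difference from `x` to `y` would be both 2a + 1 and -(2b + 2), making the odd number 2(a +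
  -- b + 1) + 1 vanish modulo `M`.
  ¬Up-Down : ∀ {i j x y} → Up i x y → ¬ Down j x y
  ¬Up-Down {x = x} {y} u@(a , _) d@(b , _) = odd≉0 (toℕ a + suc (toℕ b)) (+-cancelˡ-≈ (toℕ x)
    (≈-trans (≈-reflexive (eq (toℕ x) (toℕ a) (suc (toℕ b))))
      (≈-trans (+-cong-≈ (≈-sym (up-difference u)) (≈-refl {suc (toℕ b) + suc (toℕ b)}))
        (≈-trans (≈-sym (down-difference d)) (≈-reflexive (sym (+-identityʳ (toℕ x))))))))
    where
    eq : ∀ x a b → x + suc (a + b + (a + b)) ≡ x + suc (a + a) + (b + b)
    eq = solve-∀

  -- The difference fixes `a`, and then the tail x = i - a fixes `i`. For `Down` arcs the head y = i
  -- - a - 1 does so.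
  Up-disjoint : ∀ {i j x y} → Up i x y → Up j x y → i ≡ j
  Up-disjoint {i} {j} {x} u@(a , x+a≈i , _) w@(b , x+b≈j , _) =
    ≈⇒≡-Fin (≈-trans (≈-sym x+a≈i) (≈-trans (≈-reflexive (cong (λ c → toℕ x + c) a≡b)) x+b≈j))
    where
    a≡b : toℕ a ≡ toℕ b
    a≡b = m+m-injective (suc-injective (≈⇒≡ (up-bound a) (up-bound b)
      (+-cancelˡ-≈ (toℕ x) (≈-trans (≈-sym (up-difference u)) (up-difference w)))))

  Down-disjoint : ∀ {i j x y} → Down i x y → Down j x y → i ≡ j
  Down-disjoint {i} {j} {x} {y} u@(a , _ , y+a≈i) w@(b , _ , y+b≈j) =
    ≈⇒≡-Fin (≈-trans (≈-sym y+a≈i) (≈-trans (≈-reflexive (cong (λ c → toℕ y + c) a≡b)) y+b≈j))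
    where
    a≡b : suc (toℕ a) ≡ suc (toℕ b)
    a≡b = m+m-injective (≈⇒≡ (down-bound a) (down-bound b)
      (+-cancelˡ-≈ (toℕ y) (≈-trans (≈-sym (down-difference u)) (down-difference w))))

  cycle-disjoint : ∀ i j x y → Cycle i x y → Cycle j x y → i ≡ j
  cycle-disjoint i j zero    (suc y) e f = trans (sym e) f
  cycle-disjoint i j (suc x) zero    e f = ≈⇒≡-Fin (+-cancelˡ-≈ m
    (≈-trans (≈-reflexive (+-comm m (toℕ i))) (≈-trans (≈-sym e) (≈-trans f (≈-reflexive (+-comm (toℕ j) m))))))
  cycle-disjoint i j (suc x) (suc y) (inj₁ u) (inj₁ w) = Up-disjoint u w
  cycle-disjoint i j (suc x) (suc y) (inj₁ u) (inj₂ w) = contradiction w (¬Up-Down u)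
  cycle-disjoint i j (suc x) (suc y) (inj₂ u) (inj₁ w) = contradiction u (¬Up-Down w)
  cycle-disjoint i j (suc x) (suc y) (inj₂ u) (inj₂ w) = Down-disjoint u w

  cycle-loopless : ∀ i x → ¬ Cycle i x x
  cycle-loopless i (suc x) (inj₁ u@(a , _)) = odd≉0 (toℕ a) (+-cancelˡ-≈ (toℕ x)
    (≈-trans (≈-sym (up-difference u)) (≈-reflexive (sym (+-identityʳ (toℕ x))))))
  -- An even difference escapes the parity argument, but it lies strictly between 0 and `M`.
  cycle-loopless i (suc x) (inj₂ d@(a , _)) = 0≢1+n (≈⇒≡ (s≤s z≤n) (down-bound a)
    (+-cancelˡ-≈ (toℕ x) (≈-trans (≈-reflexive (+-identityʳ (toℕ x))) (down-difference d))))

  module _ (i : Fin M) where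

    -- x = i − a and x = i + a + 1
    Left Right : ℕ → Fin M → Set
    Left  a x = toℕ x + a ≈ toℕ i
    Right a x = toℕ x ≈ toℕ i + suc a

    left-exists : ∀ a → ∃ (Left a)
    left-exists = difference (toℕ i)

    right-exists : ∀ a → ∃ (Right a)
    right-exists a = residue (toℕ i + suc a)

    left→right : ∀ {a x y} → a ≤ p → Left a x → Right a y → Cycle i (suc x) (suc y)
    left→right {a} {x} {y} a≤p l r = inj₁ (fromℕ< (s≤s a≤p) ,
      subst (λ a → Left a x × Right a y) (sym (toℕ-fromℕ< (s≤s a≤p))) (l , r))

    right→left : ∀ {a x y} → a < p → Right a x → Left (suc a) y → Cycle i (suc x) (suc y)
    right→left {a} {x} {y} a<p r l = inj₂ (fromℕ< a<p ,
      subst (λ a → Right a x × Left (suc a) y) (sym (toℕ-fromℕ< a<p)) (r , l))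

    -- The recursion goes back along the zigzag to i, the successor of ∞, and appends the arcs on
    -- its return.
    from-∞ˡ : ∀ a → a ≤ p → ∀ {x} → Left a x → Star (Cycle i) zero (suc x)
    from-∞ʳ : ∀ a → a ≤ p → ∀ {x} → Right a x → Star (Cycle i) zero (suc x)
    from-∞ˡ zero    _   {x} l = ≈⇒≡-Fin (≈-trans (≈-reflexive (sym (+-identityʳ (toℕ x)))) l) ◅ ε
    from-∞ˡ (suc a) a<p     l with right-exists a
    ... | y , r = from-∞ʳ a (<⇒≤ a<p) r ◅◅ right→left a<p r l ◅ ε
    from-∞ʳ a a≤p r with left-exists a
    ... | y , l = from-∞ˡ a a≤p l ◅◅ left→right a≤p l r ◅ ε

    -- `d` counts the rounds left before the last vertex i + m; it falls as `a` grows and makes the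
    -- forward walk terminate.
    to-∞ˡ : ∀ d a → d + a ≡ p → ∀ {x} → Left a x → Star (Cycle i) (suc x) zero
    to-∞ʳ : ∀ d a → d + a ≡ p → ∀ {x} → Right a x → Star (Cycle i) (suc x) zero
    to-∞ˡ d a e l with right-exists a
    ... | y , r = left→right (subst (a ≤_) e (m≤n+m a d)) l r ◅ to-∞ʳ d a e r
    -- Here `a` is `p`, so the vertex is i + suc p = i + m, the tail of the arc into ∞.
    to-∞ʳ zero    a refl r = r ◅ ε
    to-∞ʳ (suc d) a e    r with left-exists (suc a)
    ... | y , l = right→left (subst (suc a ≤_) e (s≤s (m≤n+m a d))) r l
                  ◅ to-∞ˡ d (suc a) (trans (+-suc d a) e) l

    -- The offset s = x - i is taken in 0, ..., M - 1. Offset 0 is the start, offsets a + 1 up to m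
    -- lie to the right, and a larger s is the step -(M - s) to the left.
    position : ∀ x → ∃ λ a → a ≤ p × (Left a x ⊎ Right a x)
    position x = let (r , r+i≈x) = difference (toℕ x) (toℕ i) in locate (toℕ r) (toℕ<n r) r+i≈x
      where
      locate : ∀ s → s < M → s + toℕ i ≈ toℕ x → ∃ λ a → a ≤ p × (Left a x ⊎ Right a x)
      locate s s<M s+i≈x with s ≤? m
      locate zero    _ s+i≈x | yes _   = 0 , z≤n ,
        inj₁ (≈-trans (≈-reflexive (+-identityʳ (toℕ x))) (≈-sym s+i≈x))
      locate (suc a) _ s+i≈x | yes s≤m = a , s≤s⁻¹ s≤m ,
        inj₂ (≈-trans (≈-sym s+i≈x) (≈-reflexive (+-comm (suc a) (toℕ i))))
      locate s s<M s+i≈x | no s≰m = a , a≤p , inj₁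
        (≈-trans (+-cong-≈ (≈-sym s+i≈x) (≈-refl {a})) (≈-trans (≈-reflexive eq) (m+kM≈m (toℕ i) 1)))
        where
        a : ℕ
        a = M ∸ s
        a+s : a + s ≡ M
        a+s = m∸n+n≡m (<⇒≤ s<M)
        a≤p : a ≤ p
        -- From s ≥ m + 1 and M = p + (m + 1).
        a≤p = +-cancelʳ-≤ (suc m) a p (≤-trans (+-monoʳ-≤ a (≰⇒> s≰m))
          (≤-reflexive (trans a+s (sym (+-suc p m)))))
        lemma : ∀ s i a → s + i + a ≡ i + (a + s)
        lemma = solve-∀
        eq : s + toℕ i + a ≡ toℕ i + 1 * M
        eq = trans (lemma s (toℕ i) a) (cong (λ c → toℕ i + c) (trans a+s (sym (+-identityʳ M))))

    cycle-strong : ∀ x y → Star (Cycle i) x y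
    cycle-strong x y = to-∞ x ◅◅ from-∞ y
      where
      to-∞ : ∀ x → Star (Cycle i) x zero
      to-∞ zero = ε
      to-∞ (suc x) with position x
      ... | a , a≤p , inj₁ l = to-∞ˡ (p ∸ a) a (m∸n+n≡m a≤p) l
      ... | a , a≤p , inj₂ r = to-∞ʳ (p ∸ a) a (m∸n+n≡m a≤p) r
      from-∞ : ∀ x → Star (Cycle i) zero x
      from-∞ zero = ε
      from-∞ (suc x) with position x
      ... | a , a≤p , inj₁ l = from-∞ˡ a a≤p l
      ... | a , a≤p , inj₂ r = from-∞ʳ a a≤p r

  cyclePacking : (D : Digraph (suc M)) (S : Subset (suc M)) (f : Fin l → Fin M) →
    (∀ i j → f i ≡ f j → i ≡ j) → (∀ i x y → Cycle (f i) x y → x ⟶[ arcs D ] y) → Packing D S l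
  cyclePacking D S f f-inj C⊆D = relationPacking (λ _ → ⊤) (λ i → Cycle (f i)) (λ i → cycle? (f i)) C⊆D
    (λ _ _ _ _ → ∈⊤ , ∈⊤) (λ i x y _ _ → cycle-strong (f i) x y) (λ _ _ → ∈⊤)
    (λ i j x y c d → f-inj i j (cycle-disjoint (f i) (f j) x y c d))

  complete-packing : Packing (complete (suc M)) ⊤ M
  complete-packing = cyclePacking (complete (suc M)) ⊤ id (λ _ _ e → e)
    λ { i x y c → complete⁺ {suc M} {x} {y} λ { refl → cycle-loopless i x c } }

  -- The indices in `Fin M` split as m + m. The first m cycles make up `half`; arc-disjointness puts
  -- the other m into its complement.
  InHalf : Fin (suc M) → Fin (suc M) → Set
  InHalf x y = ∃ λ (i : Fin m) → Cycle (i ↑ˡ m) x y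

  inHalf? : ∀ x y → Dec (InHalf x y)
  inHalf? x y = any? λ i → cycle? (i ↑ˡ m) x y

  half : Digraph (suc M)
  half = digraph inHalf? λ { x (i , c) → cycle-loopless (i ↑ˡ m) x c }

  half-packing : ∀ S → Packing half S m
  half-packing S = cyclePacking half S (_↑ˡ m) (↑ˡ-injective m) λ i x y c → arcSet⁺ inHalf? (i , c)

  ↑ˡ≢↑ʳ : (i j : Fin m) → i ↑ˡ m ≢ m ↑ʳ j
  ↑ˡ≢↑ʳ i j e with () ← trans (sym (splitAt-↑ˡ m i m)) (trans (cong (splitAt m) e) (splitAt-↑ʳ m m j))

  halfᶜ-packing : ∀ S → Packing (half ᶜ) S m
  halfᶜ-packing S = cyclePacking (half ᶜ) S (m ↑ʳ_) (↑ʳ-injective m) λ i x y c →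
    Equivalence.from (ᶜ-arcs half x y)
      ( (λ { refl → cycle-loopless (m ↑ʳ i) x c })
      , λ a → let (j , c′) = arcSet⁻ inHalf? a
              in ↑ˡ≢↑ʳ j i (cycle-disjoint (j ↑ˡ m) (m ↑ʳ i) x y c′ c) )

-- Extremal digraphs.

-- Packings bound each of the two values below by m and their sum is at most 2m. Fixing both values,
-- not only the sum, is what the product bound needs.
sum-tight : ∀ {a b c d} → a ≤ c → b ≤ d → c + d ≤ a + b → c ≡ a × d ≡ b
sum-tight {a} {b} {c} {d} a≤c b≤d c+d≤a+b =
  ≤-antisym (+-cancelʳ-≤ b c a (≤-trans (+-monoʳ-≤ c b≤d) c+d≤a+b)) a≤c ,
  ≤-antisym (+-cancelˡ-≤ a d b (≤-trans (+-monoˡ-≤ d a≤c) c+d≤a+b)) b≤d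

odd-extremal : ∀ m k → 2 ≤ k → k ≤ suc (m + m) → ∃ λ (D : Digraph (suc (m + m))) →
  ∀ {a b} → Isλ-k k D a → Isλ-k k (D ᶜ) b → a ≡ m × b ≡ m
odd-extremal zero    k 2≤k k≤n = contradiction (≤-trans 2≤k k≤n) λ { (s≤s ()) }
odd-extremal (suc p) k 2≤k k≤n = half , λ isa isb → sum-tight
  (packings⇒≤λₖ isa λ S _ → half-packing S)
  (packings⇒≤λₖ isb λ S _ → halfᶜ-packing S)
  (λₖ-sum-bound 2≤k k≤n isa isb)
  where open Zigzag p

-- The complete digraph alone already reaches `N`, and the sum bound caps the total there.
complete-extremal : ∀ {N k} → 2 ≤ k → k ≤ suc N →
  (∀ S → ∣ S ∣ ≡ k → Packing (complete (suc N)) S N) →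
  ∀ {a b} → Isλ-k k (complete (suc N)) a → Isλ-k k (complete (suc N) ᶜ) b → a + b ≡ N
complete-extremal 2≤k k≤n P isa isb =
  ≤-antisym (λₖ-sum-bound 2≤k k≤n isa isb) (≤-trans (packings⇒≤λₖ isa P) (m≤m+n _ _))

complete-packing-1+odd : ∀ p (S : Subset (suc (suc p) + suc (suc p))) → ∣ S ∣ < suc (suc p) + suc (suc p) →
                     Packing (complete (suc (suc p) + suc (suc p))) S (suc p + suc (suc p))
-- In terms of the modulus `M` of `Zigzag p`, the rewrite makes the order `suc (suc M)`: deleting
-- `v` leaves `suc M` vertices with `M` cycles, and the star is the last of the `suc M` members.
complete-packing-1+odd p rewrite +-suc p (suc p) = λ S ∣S∣<n →
  let (v , v∉S) = missed-vertex S ∣S∣<n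
  in starPacking v S (λ _ → v∉S) (Zigzag.complete-packing p)

even-extremal : ∀ p k → 2 ≤ k → k ≤ suc p + suc p → k < suc p + suc p ⊎ suc p + suc p ≡ 2 →
  ∃ λ (D : Digraph (suc p + suc p)) → ∀ {a b} → Isλ-k k D a → Isλ-k k (D ᶜ) b → a + b ≡ p + suc p
-- For n = 2 the star at `zero` is the pair of opposite arcs and suffices by itself.
even-extremal zero k 2≤k k≤n _ = complete 2 , complete-extremal 2≤k k≤n
  λ S _ → starPacking zero S (λ ()) (emptyPacking (complete 1) ⊤)
even-extremal (suc p) k 2≤k k≤n (inj₂ e) =
  contradiction (m+m-injective {suc (suc p)} {1} e) λ ()
even-extremal (suc p) k 2≤k k≤n (inj₁ k<n) = complete _ , complete-extremal 2≤k k≤n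
  λ S ∣S∣ → complete-packing-1+odd p S (subst (_< _) (sym ∣S∣) k<n)

-- For odd n the halved cycle family works for every `k`; for even n the alternatives left are k < n
-- and n = 2.
sum-extremal : ∀ n k → 2 ≤ k → k ≤ n → k < n ⊎ ¬ (2 ∣ n) ⊎ n ≡ 2 →
  ∃ λ (D : Digraph n) → ∀ {a b} → Isλ-k k D a → Isλ-k k (D ᶜ) b → a + b ≡ n ∸ 1
sum-extremal n k 2≤k k≤n h with even⊎odd n
... | m , inj₂ refl with odd-extremal m k 2≤k k≤n
...   | D , e = D , λ isa isb → uncurry (cong₂ _+_) (e isa isb)
sum-extremal _ k 2≤k k≤n h | zero  , inj₁ refl = contradiction (≤-trans 2≤k k≤n) λ ()
sum-extremal _ k 2≤k k≤n h | suc p , inj₁ refl = even-extremal p k 2≤k k≤n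
  (Sum.[ inj₁ , Sum.[ (λ 2∤n → contradiction (2∣m+m (suc p)) 2∤n) , inj₂ ] ] h)

-- For n = 2m + 1 the bound is the integer m², reached when both values equal m.
product-extremal : ∀ n k → 2 ≤ k → k ≤ n → ¬ (2 ∣ n) →
  ∃ λ (D : Digraph n) → ∀ {a b} → Isλ-k k D a → Isλ-k k (D ᶜ) b →
  (+ (a * b)) / 1 ≡ ((+ (n ∸ 1)) / 2) ℚ.* ((+ (n ∸ 1)) / 2)
product-extremal n k 2≤k k≤n 2∤n with even⊎odd n
... | m , inj₁ refl = contradiction (2∣m+m m) 2∤n
... | m , inj₂ refl with odd-extremal m k 2≤k k≤n
...   | D , e = D , λ {a} {b} isa isb →
  ≡[N/2]² (a * b) (m + m) (trans (cong (_* 4) (uncurry (cong₂ _*_) (e isa isb))) (eq m))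
  where
  eq : ∀ m → m * m * 4 ≡ (m + m) * (m + m)
  eq = solve-∀

-- Bounds, equality cases and sharpness combined.

-- The connectivities enter only through their specifications: the checker must
-- not unfold the exhaustive searches that define λₖ.
nordhaus-gaddum : (n k : ℕ) → 2 ≤ k → k ≤ n → (λk λarc : Digraph n → ℕ) →
  (∀ D → Isλ-k k D (λk D)) → (∀ D → IsArcStrongConnectivity D (λarc D)) →
  ( ((D : Digraph n) →
        0 ≤ λk D + λk (D ᶜ)
      × λk D + λk (D ᶜ) ≤ n ∸ 1
      × (λk D + λk (D ᶜ) ≡ 0 ⇔ (λarc D ≡ 0 × λarc (D ᶜ) ≡ 0)))
  × (∃ λ (D : Digraph n) → λk D + λk (D ᶜ) ≡ 0)
  × (k < n ⊎ ¬ (2 ∣ n) ⊎ n ≡ 2 →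
      ∃ λ (D : Digraph n) → λk D + λk (D ᶜ) ≡ n ∸ 1) )
  ×
  ( ((D : Digraph n) →
        0 ≤ λk D * λk (D ᶜ)
      × (+ (λk D * λk (D ᶜ))) / 1 ℚ.≤ ((+ (n ∸ 1)) / 2) ℚ.* ((+ (n ∸ 1)) / 2)
      × (λk D * λk (D ᶜ) ≡ 0 ⇔ (λarc D ≡ 0 ⊎ λarc (D ᶜ) ≡ 0)))
  × (∃ λ (D : Digraph n) → λk D * λk (D ᶜ) ≡ 0)
  × (¬ (2 ∣ n) →
      ∃ λ (D : Digraph n) → (+ (λk D * λk (D ᶜ))) / 1 ≡ ((+ (n ∸ 1)) / 2) ℚ.* ((+ (n ∸ 1)) / 2)) )
nordhaus-gaddum n k 2≤k k≤n λk λarc spec spec′ =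
  ( (λ D → z≤n , sum-bound D , mk⇔
      (λ e → to (λₖ≡0 D) (m+n≡0⇒m≡0 (λk D) e) , to (λₖ≡0 (D ᶜ)) (m+n≡0⇒n≡0 (λk D) e))
      (λ (e , eᶜ) → cong₂ _+_ (from (λₖ≡0 D) e) (from (λₖ≡0 (D ᶜ)) eᶜ)))
  , (T , cong₂ _+_ T≡0 Tᶜ≡0)
  , λ h → let (D , e) = sum-extremal n k 2≤k k≤n h in D , e (spec D) (spec (D ᶜ)) )
  ,
  ( (λ D → z≤n
      -- With denominators cleared: AM-GM, followed by the square of the sum bound.
      , ≤[N/2]² (λk D * λk (D ᶜ)) (n ∸ 1)
          (≤-trans (4ab≤[a+b]² (λk D) (λk (D ᶜ))) (*-mono-≤ (sum-bound D) (sum-bound D)))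
      , mk⇔
          (λ e → Sum.map (to (λₖ≡0 D)) (to (λₖ≡0 (D ᶜ))) (m*n≡0⇒m≡0∨n≡0 (λk D) e))
          Sum.[ (λ e → cong (_* λk (D ᶜ)) (from (λₖ≡0 D) e))
              , (λ eᶜ → trans (cong (λk D *_) (from (λₖ≡0 (D ᶜ)) eᶜ)) (*-zeroʳ (λk D))) ])
  , (T , cong₂ _*_ T≡0 Tᶜ≡0)
  , λ h → let (D , e) = product-extremal n k 2≤k k≤n h in D , e (spec D) (spec (D ᶜ)) )
  where
  open Equivalence using (to; from)
  2≤n : 2 ≤ n
  2≤n = ≤-trans 2≤k k≤n
  sum-bound : (D : Digraph n) → λk D + λk (D ᶜ) ≤ n ∸ 1
  sum-bound D = λₖ-sum-bound 2≤k k≤n (spec D) (spec (D ᶜ))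
  λₖ≡0 : (D : Digraph n) → λk D ≡ 0 ⇔ λarc D ≡ 0
  λₖ≡0 D = λₖ≡0⇔λ≡0 2≤k k≤n (spec D) (spec′ D)
  T : Digraph n
  T = transitiveTournament n
  T≡0 : λk T ≡ 0
  T≡0 = ¬strong⇒λₖ≡0 2≤k k≤n (spec T) (transitiveTournament-¬strong 2≤n)
  Tᶜ≡0 : λk (T ᶜ) ≡ 0
  Tᶜ≡0 = ¬strong⇒λₖ≡0 2≤k k≤n (spec (T ᶜ)) (transitiveTournamentᶜ-¬strong 2≤n)

theorem3p11 : (n k : ℕ) (2≤k : 2 ≤ k) (k≤n : k ≤ n) →
  let λk : Digraph n → ℕ
      λk D = λₖ k D 2≤k k≤n
      λarc : Digraph n → ℕ
      λarc D = arcStrongConnectivity D (≤-trans 2≤k k≤n)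
      bound : ℚ
      bound = ((+ (n ∸ 1)) / 2) ℚ.* ((+ (n ∸ 1)) / 2)
  in
  -- (i)
  ( ((D : Digraph n) →
        0 ≤ λk D + λk (D ᶜ)
      × λk D + λk (D ᶜ) ≤ n ∸ 1
      × (λk D + λk (D ᶜ) ≡ 0 ⇔ (λarc D ≡ 0 × λarc (D ᶜ) ≡ 0)))
  × (∃ λ (D : Digraph n) → λk D + λk (D ᶜ) ≡ 0)
  × (k < n ⊎ ¬ (2 ∣ n) ⊎ n ≡ 2 →
      ∃ λ (D : Digraph n) → λk D + λk (D ᶜ) ≡ n ∸ 1) )
  ×
  -- (ii)
  ( ((D : Digraph n) →
        0 ≤ λk D * λk (D ᶜ)
      × (+ (λk D * λk (D ᶜ))) / 1 ℚ.≤ bound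
      × (λk D * λk (D ᶜ) ≡ 0 ⇔ (λarc D ≡ 0 ⊎ λarc (D ᶜ) ≡ 0)))
  × (∃ λ (D : Digraph n) → λk D * λk (D ᶜ) ≡ 0)
  × (¬ (2 ∣ n) →
      ∃ λ (D : Digraph n) → (+ (λk D * λk (D ᶜ))) / 1 ≡ bound) )
theorem3p11 n k 2≤k k≤n = nordhaus-gaddum n k 2≤k k≤n
  (λ D → λₖ k D 2≤k k≤n) (λ D → arcStrongConnectivity D (≤-trans 2≤k k≤n))
  (λ D → λₖ-spec k D 2≤k k≤n) (λ D → arcStrongConnectivity-spec D (≤-trans 2≤k k≤n))
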